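{- If $c\geq 2$, then $\mathit{fw}(I_{c}D_{c}I_{c}D_{c})=2c+3$.
   Context: A sequence $s$ contains a sequence $u$ if some subsequence of $s$ can be changed into $u$ by a one-to-one renaming of its letters. An $(r,s)$-formation is a concatenation of $s$ permutations of the same set of $r$ distinct letters. The formation width $\mathit{fw}(u)$ is the minimum $s$ such that there exists $r$ for which every $(r,s)$-formation contains $u$. $I_c$ denotes $1\,2\ldots c$ and $D_c$ denotes $c\,(c-1)\ldots 1$. -}

module Defs where

open import Data.Nat using (ℕ; suc; _<_)
open import Data.List using (List; map; upTo; reverse; _++_; concat; length)
open import Data.List.Relation.Binary.Sublist.Propositional using (_⊆_)
open import Data.List.Relation.Binary.Permutation.Propositional using (_↭_)
open import Data.List.Relation.Unary.Unique.Propositional using (Unique)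
open import Data.List.Relation.Unary.All using (All)
open import Data.List.Membership.Propositional using (_∈_)
open import Data.Product using (Σ; ∃; _×_)
open import Relation.Binary.PropositionalEquality using (_≡_)
open import Relation.Nullary using (¬_)

Seq : Set
Seq = List ℕ

Contains : Seq → Seq → Set
Contains s u =
  Σ Seq λ v → (v ⊆ s) ×
    Σ (ℕ → ℕ) λ f →
      (∀ {x y} → x ∈ v → y ∈ v → f x ≡ f y → x ≡ y) × (map f v ≡ u)

IsFormation : ℕ → ℕ → Seq → Set
IsFormation r s w =
  Σ Seq λ S → Unique S × (length S ≡ r) ×
    Σ (List Seq) λ ps → (length ps ≡ s) × All (λ p → p ↭ S) ps × (concat ps ≡ w)

FwAdmissible : Seq → ℕ → Set
FwAdmissible u s = ∃ λ r → ∀ w → IsFormation r s w → Contains w u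

FormationWidth : Seq → ℕ → Set
FormationWidth u n = FwAdmissible u n × (∀ s → s < n → ¬ FwAdmissible u s)

I : ℕ → Seq
I c = map suc (upTo c)

D : ℕ → Seq
D c = reverse (I c)

{-# OPTIONS --safe #-}

-- Upper bound.  By iterated Erdős–Szekeres, a formation on enough letters has
-- c letters T such that every permutation contains T or its reverse.  Among the
-- first c + 3 permutations one finds π (reverse π) π for some arrangement π of T:
-- if the orientations show T, reverse T, T in this order, take π = T; otherwise
-- they are a copies of T followed by b copies of reverse T (up to swapping the
-- two), a + b = c + 3, and one takes π = L (reverse R) with T = L R and
-- ∣L∣ = b - 2, except when a = 1 or b ≤ 1, where π = T works.  The last c
-- permutations contain any c letters of T in any order, in particular reverse π.
--
-- Lower bound.  With U increasing and V decreasing, the formation Uᶜ V V Uᶜ fails.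
-- The word G = π (reverse π) has c non-ascents, so it is not contained in Uᶜ.
-- Let p q be the first two letters of π.  If p < q, then G without its first
-- letter still has c non-ascents, so the word p p q straddling the middle of G G
-- would have to be contained in V V, which it is not; if q < p, the same argument
-- with G without its last letter applies to q p p.
module Submission where

open import Defs
open import Data.Nat using (ℕ; zero; suc; _≤_; _<_; _>_; _+_; _*_; z≤n; s≤s; s≤s⁻¹; _<?_; _≟_)
open import Data.Nat.Properties
open import Data.Nat.Solver using (module +-*-Solver)
open import Data.List
  using (List; []; _∷_; [_]; map; upTo; take; reverse; replicate; _++_; _∷ʳ_; concat; length)
open import Data.List.Properties
open import Data.List.Membership.Propositional using (_∈_; _∉_)
open import Data.List.Membership.Propositional.Properties using (∈-∃++; ∈-++⁻)
open import Data.List.Relation.Binary.Permutation.Propositional using (_↭_; ↭⇒↭ₛ; ↭-refl; ↭-sym; ↭-trans)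
open import Data.List.Relation.Binary.Permutation.Propositional.Properties
  using (∈-resp-↭; All-resp-↭; ↭-reverse; ↭-length) renaming (++⁺ˡ to ↭-++⁺ˡ)
open import Data.List.Relation.Binary.Permutation.Setoid.Properties using (Unique-resp-↭)
open import Data.List.Relation.Binary.Sublist.Propositional
  using (_⊆_; []; _∷_; ⊆-refl; ⊆-trans; ⊆-reflexive; minimum; from∈; lookup) renaming (_∷ʳ_ to _∷⁻_)
open import Data.List.Relation.Binary.Sublist.Propositional.Properties
  using (All-resp-⊆; ++⁺; ++⁺ˡ; ++⁺ʳ; reverse⁺; take-⊆)
open import Data.List.Relation.Unary.All as All using (All; []; _∷_)
import Data.List.Relation.Unary.All.Properties as Allₚ
open import Data.List.Relation.Unary.AllPairs using (AllPairs; []; _∷_)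
import Data.List.Relation.Unary.AllPairs.Properties as AllPairsₚ
open import Data.List.Relation.Unary.Any using (here; there)
open import Data.List.Relation.Unary.Unique.Propositional using (Unique)
import Data.List.Relation.Unary.Unique.Propositional.Properties as Uniqueₚ
open import Data.Product using (∃; ∃₂; _×_; _,_)
open import Data.Sum using (_⊎_; inj₁; inj₂) renaming (map to ⊎-map)
open import Data.Empty using (⊥)
open import Level using (0ℓ)
open import Function using (_∘_; id)
open import Relation.Nullary using (¬_; yes; no; contradiction)
open import Relation.Unary using (Pred)
open import Relation.Binary using (Rel; tri<; tri≈; tri>)
open import Relation.Binary.PropositionalEquality hiding ([_])

private
  variable
    A B : Set
    x : A
    xs ys : List A
    ps qs : List (List A)

-- Sublists and concatenations.

AllPairs-resp-⊇ : ∀ {R : Rel A 0ℓ} → xs ⊆ ys → AllPairs R ys → AllPairs R xs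
AllPairs-resp-⊇ []         []       = []
AllPairs-resp-⊇ (_ ∷⁻ τ)   (_ ∷ rs) = AllPairs-resp-⊇ τ rs
AllPairs-resp-⊇ (refl ∷ τ) (r ∷ rs) = All-resp-⊆ τ r ∷ AllPairs-resp-⊇ τ rs

split-length : ∀ m {n} (xs : List A) → length xs ≡ m + n →
               ∃₂ λ ys zs → xs ≡ ys ++ zs × length ys ≡ m × length zs ≡ n
split-length zero    xs       eq = [] , xs , refl , refl , eq
split-length (suc m) (x ∷ xs) eq with split-length m xs (suc-injective eq)
... | ys , zs , refl , refl , eq′ = x ∷ ys , zs , refl , refl , eq′

concat-⊆-++ : xs ⊆ concat ps → ys ⊆ concat qs → xs ++ ys ⊆ concat (ps ++ qs)
concat-⊆-++ {ps = ps} {qs = qs} σ τ = subst (_ ⊆_) (concat-++ ps qs) (++⁺ σ τ)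

concat-⊆ : ps ⊆ qs → concat ps ⊆ concat qs
concat-⊆ []         = []
concat-⊆ (q ∷⁻ τ)   = ++⁺ˡ q (concat-⊆ τ)
concat-⊆ (refl ∷ τ) = ++⁺ ⊆-refl (concat-⊆ τ)

-- Erdős–Szekeres

partition-⊎ : ∀ {P Q : Pred A 0ℓ} {xs : List A} → All (λ x → P x ⊎ Q x) xs →
              ∃₂ λ ys zs → ys ⊆ xs × zs ⊆ xs × All P ys × All Q zs ×
                           length xs ≡ length ys + length zs
partition-⊎ [] = [] , [] , [] , [] , [] , [] , refl
partition-⊎ {xs = x ∷ _} (r ∷ rs) with partition-⊎ rs | r
... | ys , zs , σ , τ , ps , qs , eq | inj₁ p =
  x ∷ ys , zs , refl ∷ σ , x ∷⁻ τ , p ∷ ps , qs , cong suc eq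
... | ys , zs , σ , τ , ps , qs , eq | inj₂ q =
  ys , x ∷ zs , x ∷⁻ σ , refl ∷ τ , ps , q ∷ qs ,
  trans (cong suc eq) (sym (+-suc (length ys) (length zs)))

+-≤-pigeonhole : ∀ a b {m n} → a + b ≤ m + n → a ≤ m ⊎ b ≤ n
+-≤-pigeonhole a b {m} {n} le with ≤-<-connex a m
... | inj₁ a≤m = inj₁ a≤m
... | inj₂ m<a with ≤-<-connex b n
...   | inj₁ b≤n = inj₂ b≤n
...   | inj₂ n<b = contradiction le (<⇒≱ (+-mono-< m<a n<b))

-- Pascal's recurrence shifted by one: the value is the binomial coefficient of a + b over a, minus
-- 1. The summand 1 pays for the first letter, the two others for the letters after and before it.
erdős-szekeres-bound : ℕ → ℕ → ℕ
erdős-szekeres-bound zero    b       = zero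
erdős-szekeres-bound (suc a) zero    = zero
erdős-szekeres-bound (suc a) (suc b) =
  suc (erdős-szekeres-bound a (suc b) + erdős-szekeres-bound (suc a) b)

-- The letters other than the first one x split into those occurring after x in p
-- and those occurring before; x prolongs a common subsequence of the former, and
-- a reversed one of the latter.
erdős-szekeres : ∀ a b (xs p : List A) → Unique xs → All (_∈ p) xs →
  erdős-szekeres-bound a b ≤ length xs →
  (∃ λ T → T ⊆ xs × a ≤ length T × T ⊆ p) ⊎
  (∃ λ T → T ⊆ xs × b ≤ length T × reverse T ⊆ p)
erdős-szekeres zero    b    xs p _ _ _ = inj₁ ([] , minimum xs , z≤n , minimum p)
erdős-szekeres (suc a) zero xs p _ _ _ = inj₂ ([] , minimum xs , z≤n , minimum p)
erdős-szekeres (suc a) (suc b) (x ∷ xs) p (x≢xs ∷ uxs) (x∈p ∷ xs∈p) (s≤s le)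
  with ∈-∃++ x∈p
... | p₁ , p₂ , refl
  with partition-⊎ (All.zipWith side (x≢xs , xs∈p))
  where
  side : ∀ {y} → x ≢ y × y ∈ p₁ ++ x ∷ p₂ → y ∈ p₂ ⊎ y ∈ p₁
  side (x≢y , y∈) with ∈-++⁻ p₁ y∈
  ... | inj₁ y∈p₁         = inj₂ y∈p₁
  ... | inj₂ (here y≡x)   = contradiction (sym y≡x) x≢y
  ... | inj₂ (there y∈p₂) = inj₁ y∈p₂
... | ys , zs , ys⊆ , zs⊆ , ys∈ , zs∈ , eq
  with +-≤-pigeonhole (erdős-szekeres-bound a (suc b)) (erdős-szekeres-bound (suc a) b)
         (subst (_ ≤_) eq le)
... | inj₁ big = ⊎-map
  (λ (T , T⊆ , len , sub) → x ∷ T , refl ∷ ⊆-trans T⊆ ys⊆ , s≤s len , ++⁺ˡ p₁ (refl ∷ sub))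
  (λ (T , T⊆ , len , sub) → T , x ∷⁻ ⊆-trans T⊆ ys⊆ , len , ++⁺ˡ p₁ (x ∷⁻ sub))
  (erdős-szekeres a (suc b) ys p₂ (AllPairs-resp-⊇ ys⊆ uxs) ys∈ big)
... | inj₂ big = ⊎-map
  (λ (T , T⊆ , len , sub) → T , x ∷⁻ ⊆-trans T⊆ zs⊆ , len , ++⁺ʳ (x ∷ p₂) sub)
  (λ (T , T⊆ , len , sub) → x ∷ T , refl ∷ ⊆-trans T⊆ zs⊆ , s≤s len ,
     ⊆-trans (⊆-reflexive (unfold-reverse x T)) (++⁺ sub (refl ∷ minimum p₂)))
  (erdős-szekeres (suc a) b zs p₁ (AllPairs-resp-⊇ zs⊆ uxs) zs∈ big)

-- Iterated Erdős-Szekeres.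

Oriented : List A → List A → Set
Oriented T p = T ⊆ p ⊎ reverse T ⊆ p

Oriented-resp-⊇ : xs ⊆ ys → ∀ {p} → Oriented ys p → Oriented xs p
Oriented-resp-⊇ τ (inj₁ σ) = inj₁ (⊆-trans τ σ)
Oriented-resp-⊇ τ (inj₂ σ) = inj₂ (⊆-trans (reverse⁺ τ) σ)

ramsey-bound : ℕ → ℕ → ℕ
ramsey-bound c zero    = c
ramsey-bound c (suc k) = erdős-szekeres-bound (ramsey-bound c k) (ramsey-bound c k)

-- The permutations are treated one at a time. Each shrinks the letter list to one oriented in it,
-- still long enough for those to come; passing to sublists later keeps the orientation already won.
common-orientation : ∀ c (xs : List A) (ps : List (List A)) → Unique xs →
  All (λ p → All (_∈ p) xs) ps → ramsey-bound c (length ps) ≤ length xs →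
  ∃ λ T → T ⊆ xs × c ≤ length T × All (Oriented T) ps
common-orientation c xs []       _  _          le = xs , ⊆-refl , le , []
common-orientation c xs (p ∷ ps) ux (xs∈ ∷ cs) le = shrink
  (erdős-szekeres (ramsey-bound c (length ps)) (ramsey-bound c (length ps)) xs p ux xs∈ le)
  where
  continue : ∀ {T} → T ⊆ xs → ramsey-bound c (length ps) ≤ length T → Oriented T p →
             ∃ λ T′ → T′ ⊆ xs × c ≤ length T′ × All (Oriented T′) (p ∷ ps)
  continue {T} T⊆ len o
    with common-orientation c T ps (AllPairs-resp-⊇ T⊆ ux) (All.map (All-resp-⊆ T⊆) cs) len
  ... | T′ , T′⊆ , len′ , os = T′ , ⊆-trans T′⊆ T⊆ , len′ , Oriented-resp-⊇ T′⊆ o ∷ os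

  shrink : _ → _
  shrink (inj₁ (T , T⊆ , len , sub)) = continue T⊆ len (inj₁ sub)
  shrink (inj₂ (T , T⊆ , len , sub)) = continue T⊆ len (inj₂ sub)

-- Upper bound

∈-reverse⁺ : x ∈ xs → x ∈ reverse xs
∈-reverse⁺ {xs = xs} = ∈-resp-↭ (↭-sym (↭-reverse xs))

oriented-∈ : ∀ {T p : List A} → Oriented T p → x ∈ T → x ∈ p
oriented-∈ (inj₁ σ) x∈ = lookup σ x∈
oriented-∈ (inj₂ σ) x∈ = lookup σ (∈-reverse⁺ x∈)

-- Each letter of `xs` is read from a permutation of its own, and each of these holds all letters of
-- `T`, so the order of `xs` is arbitrary.
scattered-⊆ : ∀ {T} → All (Oriented T) ps → All (_∈ T) xs → length xs ≤ length ps → xs ⊆ concat ps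
scattered-⊆ {ps = ps} os [] le = minimum (concat ps)
scattered-⊆ (o ∷ os) (x∈ ∷ xs∈) (s≤s le) =
  ++⁺ (from∈ (oriented-∈ o x∈)) (scattered-⊆ os xs∈ le)

All-∈-↭ : ∀ {T xs : List A} → xs ↭ T → All (_∈ T) xs
All-∈-↭ xs↭T = All.tabulate (∈-resp-↭ xs↭T)

-- Built from the tail: a `Q`-entry put before a sorted list keeps it sorted if the `P`-block is
-- empty; otherwise it forms a returning pair with the head of that block.
sorted-or-returning : ∀ {P Q : Pred A 0ℓ} {xs : List A} → All (λ x → P x ⊎ Q x) xs →
  (∃₂ λ ys zs → xs ≡ ys ++ zs × All P ys × All Q zs) ⊎
  (∃₂ λ q p → q ∷ p ∷ [] ⊆ xs × Q q × P p)
sorted-or-returning [] = inj₁ ([] , [] , refl , [] , [])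
sorted-or-returning {xs = x ∷ _} (r ∷ rs) with sorted-or-returning rs | r
... | inj₂ (q , p , τ , hq , hp)            | _      = inj₂ (q , p , x ∷⁻ τ , hq , hp)
... | inj₁ (ys , zs , refl , hp , hq)       | inj₁ h = inj₁ (x ∷ ys , zs , refl , h ∷ hp , hq)
... | inj₁ ([] , zs , refl , [] , hq)       | inj₂ h = inj₁ ([] , x ∷ zs , refl , [] , h ∷ hq)
... | inj₁ (y ∷ ys , zs , refl , h′ ∷ _ , _) | inj₂ h =
  inj₂ (x , y , refl ∷ refl ∷ minimum (ys ++ zs) , h , h′)

ThreefoldIn : List A → List (List A) → Set
ThreefoldIn T ps = ∃ λ π → π ↭ T × π ++ reverse π ++ π ⊆ concat ps

-- With T = L R and ∣L∣ = length bs, the arrangement π = L (reverse R) is read as follows: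
-- L and the last letter of R in a, the rest of reverse R in as, R in al,
-- reverse L in b, L in bs and reverse R in bl.
fold-back : ∀ {T : List A} {as bs : List (List A)} {a al b bl} → T ⊆ a →
  All (Oriented T) as → T ⊆ al → reverse T ⊆ b → All (Oriented T) bs → reverse T ⊆ bl →
  length T ≡ length bs + suc (length as) →
  ThreefoldIn T (a ∷ as ++ al ∷ b ∷ bs ++ bl ∷ [])
fold-back {T = T} {as} {bs} {a} {al} {b} {bl} T⊆a oas T⊆al rT⊆b obs rT⊆bl len
  with split-length (length bs) T len
... | L , R , refl , lenL , lenR = L ++ reverse R , ↭-++⁺ˡ L (↭-reverse R) ,
  subst (λ ρ → (L ++ reverse R) ++ ρ ++ L ++ reverse R ⊆ _) (sym reverse-π)
    (subst (_ ⊆_) (cong (a ++_) (concat-++ as _)) (outward (reverse R) refl))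
  where
  reverse-π : reverse (L ++ reverse R) ≡ R ++ reverse L
  reverse-π = trans (reverse-++ L (reverse R)) (cong (_++ reverse L) (reverse-involutive R))

  rT : reverse (L ++ R) ≡ reverse R ++ reverse L
  rT = reverse-++ L R

  back : (R ++ reverse L) ++ L ++ reverse R ⊆ concat (al ∷ b ∷ bs ++ bl ∷ [])
  back = subst (_⊆ _) (sym (++-assoc R (reverse L) _))
    (++⁺ (⊆-trans (++⁺ˡ L ⊆-refl) T⊆al)
    (++⁺ (⊆-trans (++⁺ˡ (reverse R) ⊆-refl) (subst (_⊆ b) rT rT⊆b))
    (concat-⊆-++ {ps = bs}
      (scattered-⊆ obs (All.tabulate (lookup (++⁺ʳ R ⊆-refl))) (≤-reflexive lenL))
      (++⁺ʳ [] (⊆-trans (++⁺ʳ (reverse L) ⊆-refl) (subst (_⊆ bl) rT rT⊆bl))))))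

  -- `C` stands for `reverse R` so that matching can split off its head, the last letter of `R`. By
  -- `lenR` it is not empty.
  outward : ∀ C → C ≡ reverse R →
    (L ++ C) ++ (R ++ reverse L) ++ L ++ C ⊆ a ++ concat as ++ concat (al ∷ b ∷ bs ++ bl ∷ [])
  outward [] eq with trans (sym lenR) (trans (sym (length-reverse R)) (cong length (sym eq)))
  ... | ()
  outward (x ∷ C) eq rewrite sym (∷ʳ-++ L x C) | ++-assoc (L ∷ʳ x) C ((R ++ reverse L) ++ (L ∷ʳ x) ++ C) =
    ++⁺ (⊆-trans (++⁺ (⊆-refl {x = L}) (from∈ (∈-R (here refl)))) T⊆a)
    (++⁺ (scattered-⊆ oas (All.tabulate (λ y∈ → lookup (++⁺ˡ L ⊆-refl) (∈-R (there y∈)))) lenC)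
    -- The rewriting has regrouped the second copy of `L ++ C` too, so `back` is adapted to that
    -- form.
    (subst (λ v → (R ++ reverse L) ++ v ⊆ _) (trans (cong (L ++_) (sym eq)) (sym (∷ʳ-++ L x C))) back))
    where
    ∈-R : ∀ {y} → y ∈ x ∷ C → y ∈ R
    ∈-R = ∈-resp-↭ (↭-reverse R) ∘ subst (_ ∈_) eq
    lenC : length C ≤ length as
    lenC = s≤s⁻¹ (≤-reflexive (trans (cong length eq) (trans (length-reverse R) lenR)))

-- Here π = `T`: it is read in `p`, `reverse T` takes one letter from each of the next `length T`
-- permutations, and the `suc k` surplus leaves a forward one for the last `T`.
threefold-long-run : ∀ {T : List A} {p} k as bs → length as ≡ length T + suc k →
  T ⊆ p → All (T ⊆_) as → ThreefoldIn T (p ∷ as ++ bs)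
threefold-long-run {T = T} k as bs eq T⊆p T⊆as with split-length (length T) as eq
... | qs , r ∷ ss , refl , lenq , _ with Allₚ.++⁻ qs T⊆as
... | T⊆qs , T⊆r ∷ _ = T , ↭-refl ,
  ++⁺ T⊆p (subst (λ ps → reverse T ++ T ⊆ concat ps) (sym (++-assoc qs (r ∷ ss) bs))
    (concat-⊆-++ {ps = qs}
      (scattered-⊆ (All.map inj₁ T⊆qs) (All-∈-↭ (↭-reverse T))
        (≤-reflexive (trans (length-reverse T) (sym lenq))))
      (++⁺ʳ _ T⊆r)))

sorted-threefold : ∀ {T : List A} {p} m n as bs → length as ≡ m → length bs ≡ n →
  m + n ≡ 2 + length T → T ⊆ p → All (T ⊆_) as → All (reverse T ⊆_) bs →
  ThreefoldIn T (p ∷ as ++ bs)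
-- Only `p` is forward: `reverse T` is read in `b`, and the last `T` is scattered over `bs`.
sorted-threefold {T = T} zero _ [] (b ∷ bs) _ refl eq T⊆p _ (rT⊆b ∷ rT⊆bs) = T , ↭-refl ,
  ++⁺ T⊆p (++⁺ rT⊆b (scattered-⊆ (All.map inj₂ rT⊆bs) (All-∈-↭ ↭-refl)
    (<⇒≤ (≤-reflexive (sym (suc-injective eq))))))
sorted-threefold {T = T} m@(suc _) zero as bs lenA _ eq T⊆p T⊆as _ =
  threefold-long-run 1 as bs (trans lenA (trans (sym (+-identityʳ m)) (trans eq (+-comm 2 (length T)))))
    T⊆p T⊆as
sorted-threefold {T = T} m@(suc _) (suc zero) as bs lenA _ eq T⊆p T⊆as _ =
  threefold-long-run 0 as bs (trans lenA (trans (suc-injective (trans (+-comm 1 m) eq)) (+-comm 1 (length T))))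
    T⊆p T⊆as
sorted-threefold {T = T} (suc m) (suc (suc n)) as bs lenA lenB eq T⊆p T⊆as rT⊆bs
  -- Setting aside the last forward permutation and the first and last reversed ones leaves ∣R∣ - 1
  -- forward and ∣L∣ reversed ones.
  with split-length m as (trans lenA (+-comm 1 m)) | split-length (suc n) bs (trans lenB (+-comm 1 (suc n)))
... | as′ , al ∷ [] , refl , refl , _ | b ∷ bs′ , bl ∷ [] , refl , refl , _
  with Allₚ.++⁻ as′ T⊆as | rT⊆bs
... | T⊆as′ , T⊆al ∷ [] | rT⊆b ∷ rT⊆bs″ with Allₚ.++⁻ bs′ rT⊆bs″
... | rT⊆bs′ , rT⊆bl ∷ [] =
  subst (ThreefoldIn T) (cong (_ ∷_) (sym (++-assoc as′ (al ∷ []) _)))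
    (fold-back T⊆p (All.map inj₁ T⊆as′) T⊆al rT⊆b (All.map inj₂ rT⊆bs′) rT⊆bl
      (suc-injective (suc-injective (trans (sym eq)
        (solve 2 (λ a b → con 1 :+ a :+ (con 2 :+ b) := con 2 :+ (b :+ (con 1 :+ a))) refl
          (length as′) (length bs′))))))
  where open +-*-Solver

threefold-from-forward : ∀ {T : List A} {p ps} → T ⊆ p → All (Oriented T) ps →
  length ps ≡ suc (suc (length T)) → ThreefoldIn T (p ∷ ps)
threefold-from-forward {T = T} T⊆p os len with sorted-or-returning os
... | inj₁ (as , bs , refl , T⊆as , rT⊆bs) =
  sorted-threefold (length as) (length bs) as bs refl refl
    (trans (sym (length-++ as)) len) T⊆p T⊆as rT⊆bs
... | inj₂ (q , r , τ , rT⊆q , T⊆r) = T , ↭-refl ,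
  ++⁺ T⊆p (⊆-trans (++⁺ rT⊆q (++⁺ʳ [] T⊆r)) (concat-⊆ τ))

Oriented-reverse : ∀ {T p : List A} → Oriented T p → Oriented (reverse T) p
Oriented-reverse {T = T} (inj₁ σ) = inj₂ (subst (_⊆ _) (sym (reverse-involutive T)) σ)
Oriented-reverse         (inj₂ σ) = inj₁ σ

-- If the first permutation is reversed, `reverse T` takes over the role of `T`; an arrangement of
-- one is an arrangement of the other.
threefold : ∀ {T : List A} {ps} → All (Oriented T) ps →
  length ps ≡ 3 + length T → ThreefoldIn T ps
threefold (inj₁ σ ∷ os) len = threefold-from-forward σ os (suc-injective len)
threefold {T = T} (inj₂ σ ∷ os) len
  with threefold-from-forward σ (All.map Oriented-reverse os)
         (trans (suc-injective len) (cong (2 +_) (sym (length-reverse T))))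
... | π , π↭ , τ = π , ↭-trans π↭ (↭-reverse T) , τ

fourfold : ∀ {T : List A} {ps} → All (Oriented T) ps → length ps ≡ 2 * length T + 3 →
  ∃ λ π → π ↭ T × π ++ reverse π ++ π ++ reverse π ⊆ concat ps
fourfold {T = T} {ps} os len
  with split-length (3 + length T) ps
         (trans len (solve 1 (λ c → con 2 :* c :+ con 3 := con 3 :+ c :+ c) refl (length T)))
  where open +-*-Solver
... | qs , rs , refl , lenq , lenr with Allₚ.++⁻ qs os
... | oqs , ors with threefold oqs lenq
... | π , π↭T , τ = π , π↭T ,
  subst (_⊆ concat (qs ++ rs))
    (trans (++-assoc π _ _) (cong (π ++_) (++-assoc (reverse π) π _)))
    (concat-⊆-++ {ps = qs} τ (scattered-⊆ ors (All-∈-↭ (↭-trans (↭-reverse π) π↭T))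
      (≤-reflexive (trans (length-reverse π) (trans (↭-length π↭T) (sym lenr))))))

-- Renaming letters by position.

position : ℕ → List ℕ → ℕ
-- This default gives an absent letter the length of the list, which makes the renaming total.
position x []       = 0
position x (y ∷ ys) with x ≟ y
... | yes _ = 0
... | no  _ = suc (position x ys)

position-injective : ∀ {x y xs} → x ∈ xs → y ∈ xs → position x xs ≡ position y xs → x ≡ y
position-injective {x} {y} {z ∷ _} x∈ y∈ eq with x ≟ z | y ≟ z
... | yes refl | yes refl = refl
position-injective (here x≡z)  _           _  | no x≢z | no _   = contradiction x≡z x≢z
position-injective (there _)   (here y≡z)  _  | no _   | no y≢z = contradiction y≡z y≢z
position-injective (there x∈)  (there y∈)  eq | no _   | no _   = position-injective x∈ y∈ (suc-injective eq)

map-position : ∀ xs → Unique xs → map (λ x → position x xs) xs ≡ upTo (length xs)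
map-position []       _           = refl
map-position (x ∷ xs) (x≢xs ∷ uxs) = cong₂ _∷_ head-position (begin
  map (λ y → position y (x ∷ xs)) xs   ≡⟨ map-cong-local (All.map tail-position x≢xs) ⟩
  map (λ y → suc (position y xs)) xs   ≡⟨ map-∘ xs ⟩
  map suc (map (λ y → position y xs) xs) ≡⟨ cong (map suc) (map-position xs uxs) ⟩
  map suc (upTo (length xs))           ≡⟨ map-upTo suc (length xs) ⟩
  _                                    ∎)
  where
  open ≡-Reasoning
  head-position : position x (x ∷ xs) ≡ 0
  head-position with x ≟ x
  ... | yes _  = refl
  ... | no x≢x = contradiction refl x≢x
  tail-position : ∀ {y} → x ≢ y → position y (x ∷ xs) ≡ suc (position y xs)
  tail-position {y} x≢y with y ≟ x
  ... | yes y≡x = contradiction (sym y≡x) x≢y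
  ... | no _    = refl

IDID : ℕ → Seq
IDID c = I c ++ D c ++ I c ++ D c

map-fourfold : (f : A → B) (π : List A) → map f (π ++ reverse π ++ π ++ reverse π) ≡
  map f π ++ reverse (map f π) ++ map f π ++ reverse (map f π)
map-fourfold f π = begin
  map f (π ++ reverse π ++ π ++ reverse π)  ≡⟨ map-++ f π _ ⟩
  map f π ++ map f (reverse π ++ π ++ reverse π)  ≡⟨ cong (map f π ++_) (map-++ f (reverse π) _) ⟩
  map f π ++ map f (reverse π) ++ map f (π ++ reverse π)
    ≡⟨ cong₂ (λ u v → map f π ++ u ++ v) (reverse-map f π)
         (trans (map-++ f π _) (cong (map f π ++_) (reverse-map f π))) ⟩
  _ ∎
  where open ≡-Reasoning

fourfold⇒Contains : ∀ {π w} → Unique π → π ++ reverse π ++ π ++ reverse π ⊆ w →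
  Contains w (IDID (length π))
fourfold⇒Contains {π} uπ τ = π ++ reverse π ++ π ++ reverse π , τ , f ,
  (λ x∈ y∈ eq → position-injective (letter x∈) (letter y∈) (suc-injective eq)) ,
  trans (map-fourfold f π) (cong (λ u → u ++ reverse u ++ u ++ reverse u)
    (trans (map-∘ π) (cong (map suc) (map-position π uπ))))
  where
  f : ℕ → ℕ
  -- Positions start at 0, the letters of `I c` at 1.
  f x = suc (position x π)
  letter : ∀ {x} → x ∈ π ++ reverse π ++ π ++ reverse π → x ∈ π
  letter = All.lookup (Allₚ.++⁺ self (Allₚ.++⁺ back (Allₚ.++⁺ self back)))
    where
    self = All-∈-↭ (↭-refl {x = π})
    back = All-∈-↭ (↭-reverse π)

IDID-admissible : ∀ c → FwAdmissible (IDID c) (2 * c + 3)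
IDID-admissible c = ramsey-bound c (2 * c + 3) , contained
  where
  contained : ∀ w → IsFormation (ramsey-bound c (2 * c + 3)) (2 * c + 3) w → Contains w (IDID c)
  contained _ (S , uS , lenS , ps , lenP , p↭S , refl)
    with common-orientation c S ps uS
           (All.map (λ p↭S → All-∈-↭ (↭-sym p↭S)) p↭S)
           (≤-reflexive (trans (cong (ramsey-bound c) lenP) (sym lenS)))
  ... | T₀ , T₀⊆S , c≤T₀ , os₀ = truncate
    where
    T : Seq
    -- `fourfold` ties the number of permutations to the length of `T`, so exactly `c` letters are
    -- kept.
    T = take c T₀
    lenT : length T ≡ c
    lenT = trans (length-take c T₀) (m≤n⇒m⊓n≡m c≤T₀)
    truncate : Contains (concat ps) (IDID c)
    truncate with fourfold {T = T} (All.map (Oriented-resp-⊇ (take-⊆ c T₀)) os₀)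
                    (trans lenP (cong (λ n → 2 * n + 3) (sym lenT)))
    ... | π , π↭T , τ = subst (Contains (concat ps) ∘ IDID) (trans (↭-length π↭T) lenT)
      (fourfold⇒Contains (Unique-resp-↭ (setoid ℕ) (↭⇒↭ₛ (↭-sym π↭T))
        (AllPairs-resp-⊇ (⊆-trans (take-⊆ c T₀) T₀⊆S) uS)) τ)

-- Lower bound

-- The place of `a` decides: in `xs` it takes along all that precedes it, in `ys` all that follows.
-- Hence `a` belongs to both alternatives.
cut : ∀ (us : List A) {a vs} xs {ys} → us ++ a ∷ vs ⊆ xs ++ ys →
      us ∷ʳ a ⊆ xs ⊎ a ∷ vs ⊆ ys
cut us       []       τ          = inj₂ (⊆-trans (++⁺ˡ us ⊆-refl) τ)
cut []       (x ∷ xs) (_ ∷⁻ τ)   = ⊎-map (x ∷⁻_) id (cut [] xs τ)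
cut []       (x ∷ xs) (refl ∷ τ) = inj₁ (refl ∷ minimum xs)
cut (u ∷ us) (x ∷ xs) (_ ∷⁻ τ)   = ⊎-map (x ∷⁻_) id (cut (u ∷ us) xs τ)
cut (u ∷ us) (x ∷ xs) (refl ∷ τ) = ⊎-map (refl ∷_) id (cut us xs τ)

skip-prefix : ∀ (xs : List A) {y vs ys} → y ∉ xs → y ∷ vs ⊆ xs ++ ys → y ∷ vs ⊆ ys
skip-prefix []       _   τ          = τ
skip-prefix (x ∷ xs) y∉  (_ ∷⁻ τ)   = skip-prefix xs (y∉ ∘ there) τ
skip-prefix (x ∷ xs) y∉  (refl ∷ _) = contradiction (here refl) y∉

-- Counting non-ascents.

nonascent : ℕ → ℕ → ℕ
nonascent x y with x <? y
... | yes _ = 0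
... | no  _ = 1

nonascent-< : ∀ {x y} → x < y → nonascent x y ≡ 0
nonascent-< {x} {y} x<y with x <? y
... | yes _   = refl
... | no  x≮y = contradiction x<y x≮y

nonascent-≮ : ∀ {x y} → ¬ x < y → nonascent x y ≡ 1
nonascent-≮ {x} {y} x≮y with x <? y
... | yes x<y = contradiction x<y x≮y
... | no  _   = refl

nonascents : List ℕ → ℕ
nonascents []           = 0
nonascents (x ∷ [])     = 0
nonascents (x ∷ y ∷ xs) = nonascent x y + nonascents (y ∷ xs)

nonascents-∷ʳ : ∀ xs q p → nonascents (xs ∷ʳ q ∷ʳ p) ≡ nonascents (xs ∷ʳ q) + nonascent q p
nonascents-∷ʳ []           q p = +-identityʳ (nonascent q p)
nonascents-∷ʳ (x ∷ [])     q p = trans (cong (nonascent x q +_) (nonascents-∷ʳ [] q p))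
  (sym (+-assoc (nonascent x q) _ _))
nonascents-∷ʳ (x ∷ y ∷ xs) q p = trans (cong (nonascent x y +_) (nonascents-∷ʳ (y ∷ xs) q p))
  (sym (+-assoc (nonascent x y) _ _))

-- `U′` is the unread rest of the current copy of `U`. Once `x` is read, all letters left in that
-- copy exceed `x`, so a non-ascent has to move on to one of the `k` later copies.
nonascents-++-replicate : ∀ k {U} → AllPairs _<_ U → ∀ U′ → AllPairs _<_ U′ → ∀ x v →
  x ∷ v ⊆ U′ ++ concat (replicate k U) → nonascents (x ∷ v) ≤ k
nonascents-++-replicate (suc k) ↗U [] _ x v τ =
  m≤n⇒m≤1+n (nonascents-++-replicate k ↗U _ ↗U x v τ)
nonascents-++-replicate k ↗U (u ∷ U′) (_ ∷ ↗U′) x v (_ ∷⁻ τ) =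
  nonascents-++-replicate k ↗U U′ ↗U′ x v τ
nonascents-++-replicate k ↗U (u ∷ U′) _ x [] (refl ∷ τ) = z≤n
nonascents-++-replicate k ↗U (u ∷ U′) (u<U′ ∷ ↗U′) x (y ∷ v) (refl ∷ τ) with x <? y
... | yes _   = nonascents-++-replicate k ↗U U′ ↗U′ y v τ
... | no  x≮y with k | skip-prefix U′ (x≮y ∘ All.lookup u<U′) τ
...   | zero  | ()
...   | suc k | τ′ = s≤s (nonascents-++-replicate k ↗U _ ↗U y v τ′)

-- The first copy is entered without a non-ascent, hence the strict inequality.
nonascents-replicate : ∀ {k U} → AllPairs _<_ U → ∀ {x v} →
  x ∷ v ⊆ concat (replicate k U) → nonascents (x ∷ v) < k
nonascents-replicate {suc k} ↗U τ = s≤s (nonascents-++-replicate k ↗U _ ↗U _ _ τ)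

double : List A → List A
double π = π ++ reverse π

double-∷ : ∀ (p : A) X → double (p ∷ X) ≡ p ∷ double X ∷ʳ p
double-∷ p X = cong (p ∷_)
  (trans (cong (X ++_) (unfold-reverse p X)) (sym (++-assoc X (reverse X) [ p ])))

nonascents-double-∷ʳ : ∀ p q X →
  nonascents (double (q ∷ X) ∷ʳ p) ≡ nonascents (double (q ∷ X)) + nonascent q p
nonascents-double-∷ʳ p q X = subst (λ h → nonascents (h ∷ʳ p) ≡ nonascents h + nonascent q p)
  (sym (double-∷ q X)) (nonascents-∷ʳ (q ∷ double X) q p)

-- Wrapping `p` around the double of `q ∷ X` adds the neighbours p q and q p; as p ≠ q, exactly one
-- of them is a non-ascent. The innermost pair, two equal letters, is the base case.
nonascents-double : ∀ p X → Unique (p ∷ X) → nonascents (double (p ∷ X)) ≡ suc (length X)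
nonascents-double p [] _ rewrite nonascent-≮ (n≮n p) = refl
nonascents-double p (q ∷ X) ((p≢q ∷ _) ∷ uX) = begin
  nonascents (double (p ∷ q ∷ X))
    ≡⟨ cong nonascents (double-∷ p (q ∷ X)) ⟩
  nonascent p q + nonascents (double (q ∷ X) ∷ʳ p)
    ≡⟨ cong (nonascent p q +_) (nonascents-double-∷ʳ p q X) ⟩
  nonascent p q + (nonascents (double (q ∷ X)) + nonascent q p)
    ≡⟨ cong (λ n → nonascent p q + (n + nonascent q p)) (nonascents-double q X uX) ⟩
  nonascent p q + (suc (length X) + nonascent q p)
    ≡⟨ one-nonascent (<-cmp p q) ⟩
  suc (suc (length X)) ∎
  where
  open ≡-Reasoning
  one-nonascent : _ → nonascent p q + (suc (length X) + nonascent q p) ≡ suc (suc (length X))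
  one-nonascent (tri< p<q _ q≮p) rewrite nonascent-< p<q | nonascent-≮ q≮p = +-comm (suc (length X)) 1
  one-nonascent (tri≈ _ p≡q _) = contradiction p≡q p≢q
  one-nonascent (tri> p≮q _ q<p) rewrite nonascent-≮ p≮q | nonascent-< q<p = cong suc (+-identityʳ _)

-- The formation that avoids the pattern.

descending-pair : ∀ {V x y} → AllPairs _>_ V → x ∷ y ∷ [] ⊆ V → y < x
descending-pair ↘V τ with AllPairs-resp-⊇ τ ↘V
... | (y<x ∷ []) ∷ _ = y<x

-- Cutting at `y` puts x y or y z inside a single decreasing `V`.
no-ascending-triple : ∀ {V x y z} → AllPairs _>_ V → x ≤ y → y ≤ z → ¬ (x ∷ y ∷ z ∷ [] ⊆ V ++ V)
no-ascending-triple {V} {x} ↘V x≤y y≤z τ with cut [ x ] V τ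
... | inj₁ σ = <⇒≱ (descending-pair ↘V σ) x≤y
... | inj₂ σ = <⇒≱ (descending-pair ↘V σ) y≤z

avoiding-formation : ℕ → Seq → Seq → List Seq
avoiding-formation c U V = replicate c U ++ V ∷ V ∷ replicate c U

avoids-double-double : ∀ {U V π} → AllPairs _<_ U → AllPairs _>_ V → Unique π → 2 ≤ length π →
  ¬ (double π ++ double π ⊆ concat (avoiding-formation (length π) U V))
avoids-double-double {π = p ∷ []} _ _ _ (s≤s ())
avoids-double-double {U} {V} {p ∷ q ∷ X} ↗U ↘V uπ@((p≢q ∷ _) ∷ uX) _ τ = by-first-pair (<-cmp p q)
  where
  c = suc (suc (length X))
  W = concat (replicate c U)
  G = double (p ∷ q ∷ X)
  H = double (q ∷ X)

  blocks : concat (avoiding-formation c U V) ≡ W ++ V ++ V ++ W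
  blocks = sym (concat-++ (replicate c U) (V ∷ V ∷ replicate c U))

  many-nonascents : ∀ {x v} → nonascents (x ∷ v) ≡ c → ¬ (x ∷ v ⊆ W)
  many-nonascents eq σ = <-irrefl eq (nonascents-replicate ↗U σ)

  nonascents-G : nonascents (p ∷ H ∷ʳ p) ≡ c
  nonascents-G = trans (cong nonascents (sym (double-∷ p (q ∷ X)))) (nonascents-double p (q ∷ X) uπ)

  by-first-pair : _ → ⊥
  by-first-pair (tri≈ _ p≡q _) = p≢q p≡q
  by-first-pair (tri< p<q _ q≮p)
    -- G G is p H p p H p. The first cut is at the last letter of the first G, the second at the q
    -- opening the second H; the part after it is G without its first letter.
    with cut (p ∷ H) W (subst₂ _⊆_
           (trans (cong (λ g → g ++ g) (double-∷ p (q ∷ X))) (++-assoc (p ∷ H) [ p ] _)) blocks τ)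
  ... | inj₁ σ = many-nonascents nonascents-G σ
  ... | inj₂ σ with cut (p ∷ p ∷ []) (V ++ V) (subst (_ ⊆_) (sym (++-assoc V V W)) σ)
  ...   | inj₁ ρ = no-ascending-triple ↘V ≤-refl (<⇒≤ p<q) ρ
  ...   | inj₂ ρ = many-nonascents
    (trans (nonascents-double-∷ʳ p q X)
      (trans (cong₂ _+_ (nonascents-double q X uX) (nonascent-≮ q≮p)) (+-comm (suc (length X)) 1))) ρ
  by-first-pair (tri> p≮q _ q<p)
    -- The cut is now at the q closing the first H, so the left part is G without its last letter;
    -- the second cut is at the first letter of the second G.
    with cut (p ∷ q ∷ double X) W (subst₂ _⊆_ split blocks τ)
    where
    split : G ++ G ≡ (p ∷ q ∷ double X) ++ q ∷ p ∷ p ∷ H ∷ʳ p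
    split = trans
      (cong₂ _++_ (trans (double-∷ p (q ∷ X)) (cong (λ h → p ∷ h ∷ʳ p) (double-∷ q X)))
                  (double-∷ p (q ∷ X)))
      (trans (++-assoc (p ∷ q ∷ double X ∷ʳ q) [ p ] _) (++-assoc (p ∷ q ∷ double X) [ q ] _))
  ... | inj₁ σ = many-nonascents {p} {q ∷ double X ∷ʳ q}
    (cong₂ _+_ (nonascent-≮ p≮q)
      (trans (cong nonascents (sym (double-∷ q X))) (nonascents-double q X uX))) σ
  ... | inj₂ σ with cut (q ∷ p ∷ []) (V ++ V) (subst (_ ⊆_) (sym (++-assoc V V W)) σ)
  ...   | inj₁ ρ = no-ascending-triple ↘V (<⇒≤ q<p) ≤-refl ρ
  ...   | inj₂ ρ = many-nonascents nonascents-G ρ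

-- Undoing the renaming.

map-++⁻ : ∀ (f : A → B) v {xs ys} → map f v ≡ xs ++ ys →
  ∃₂ λ v₁ v₂ → v ≡ v₁ ++ v₂ × map f v₁ ≡ xs × map f v₂ ≡ ys
map-++⁻ f v       {[]}     eq = [] , v , refl , refl , eq
map-++⁻ f (a ∷ v) {x ∷ xs} eq with map-++⁻ f v (∷-injectiveʳ eq)
... | v₁ , v₂ , refl , eq₁ , eq₂ =
  a ∷ v₁ , v₂ , refl , cong₂ _∷_ (∷-injectiveˡ eq) eq₁ , eq₂

map-injective-on : ∀ {f : A → B} {P : Pred A 0ℓ} →
  (∀ {x y} → P x → P y → f x ≡ f y → x ≡ y) →
  All P xs → All P ys → map f xs ≡ map f ys → xs ≡ ys
map-injective-on inj []       []       _  = refl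
map-injective-on inj (px ∷ pxs) (py ∷ pys) eq =
  cong₂ _∷_ (inj px py (∷-injectiveˡ eq)) (map-injective-on inj pxs pys (∷-injectiveʳ eq))

-- The renaming is injective only on the letters of `v`, so each block is first shown to consist of
-- such letters. Equal images then make the blocks equal to the first one or its reverse, and the
-- first has distinct letters because its image `I c` does.
Contains⇒fourfold : ∀ {w c} → Contains w (IDID c) →
  ∃ λ π → Unique π × length π ≡ c × double π ++ double π ⊆ w
Contains⇒fourfold {w} {c} (v , v⊆w , f , f-inj , eq)
  with map-++⁻ f v eq
... | v₁ , _ , refl , eq₁ , eq′
  with map-++⁻ f _ eq′
... | v₂ , _ , refl , eq₂ , eq″
  with map-++⁻ f _ eq″
... | v₃ , v₄ , refl , eq₃ , eq₄ = v₁ ,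
  Uniqueₚ.map⁻ (subst Unique (sym eq₁) (Uniqueₚ.map⁺ suc-injective (Uniqueₚ.upTo⁺ c))) ,
  trans (sym (length-map f v₁))
    (trans (cong length eq₁) (trans (length-map suc (upTo c)) (length-upTo c))) ,
  subst (_⊆ w)
    (trans (cong (v₁ ++_) (cong₂ _++_ v₂≡ (cong₂ _++_ v₃≡ v₄≡))) (sym (++-assoc v₁ _ _))) v⊆w
  where
  letters : All (_∈ v₁ ++ v₂ ++ v₃ ++ v₄) (v₁ ++ v₂ ++ v₃ ++ v₄)
  letters = All-∈-↭ ↭-refl
  in₁ = Allₚ.++⁻ˡ v₁ letters
  in₂ = Allₚ.++⁻ˡ v₂ (Allₚ.++⁻ʳ v₁ letters)
  in₃ = Allₚ.++⁻ˡ v₃ (Allₚ.++⁻ʳ v₂ (Allₚ.++⁻ʳ v₁ letters))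
  in₄ = Allₚ.++⁻ʳ v₃ (Allₚ.++⁻ʳ v₂ (Allₚ.++⁻ʳ v₁ letters))
  in₁ʳ = All-resp-↭ (↭-sym (↭-reverse v₁)) in₁

  map-reverse : map f (reverse v₁) ≡ D c
  map-reverse = trans (reverse-map f v₁) (cong reverse eq₁)
  v₂≡ : v₂ ≡ reverse v₁
  v₂≡ = map-injective-on f-inj in₂ in₁ʳ (trans eq₂ (sym map-reverse))
  v₃≡ : v₃ ≡ v₁
  v₃≡ = map-injective-on f-inj in₃ in₁ (trans eq₃ (sym eq₁))
  v₄≡ : v₄ ≡ reverse v₁
  v₄≡ = map-injective-on f-inj in₄ in₁ʳ (trans eq₄ (sym map-reverse))

-- One avoiding formation of 2c + 2 permutations serves every smaller `s`: its first `s`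
-- permutations form a prefix, and whatever a prefix contains is contained in the whole.
IDID-inadmissible : ∀ c → 2 ≤ c → ∀ s → s < 2 * c + 3 → ¬ FwAdmissible (IDID c) s
IDID-inadmissible c 2≤c s s<2c+3 (r , contains)
  with Contains⇒fourfold {c = c} (contains (concat (take s full))
         (U , Uniqueₚ.upTo⁺ r , length-upTo r , take s full , len , Allₚ.take⁺ s perms , refl))
  where
  U V : Seq
  U = upTo r
  V = reverse U
  full = avoiding-formation c U V
  perms : All (_↭ U) full
  perms = Allₚ.++⁺ (Allₚ.replicate⁺ c ↭-refl)
    (↭-reverse U ∷ ↭-reverse U ∷ Allₚ.replicate⁺ c ↭-refl)
  length-full : length full ≡ 2 * c + 2
  length-full rewrite length-++ (replicate c U) {V ∷ V ∷ replicate c U} | length-replicate c {U} =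
    solve 1 (λ c → c :+ (con 2 :+ c) := con 2 :* c :+ con 2) refl c
    where open +-*-Solver
  len : length (take s full) ≡ s
  len = trans (length-take s full) (m≤n⇒m⊓n≡m
    (≤-trans (s≤s⁻¹ (≤-trans s<2c+3 (≤-reflexive (+-suc (2 * c) 2)))) (≤-reflexive (sym length-full))))
... | π , uπ , refl , τ = avoids-double-double
  (AllPairsₚ.applyUpTo⁺₁ id r (λ i<j _ → i<j))
  (subst (AllPairs _>_) (sym (reverse-upTo r)) (AllPairsₚ.applyDownFrom⁺₁ id r (λ j<i _ → j<i)))
  uπ 2≤c
  (⊆-trans τ (concat-⊆ (take-⊆ s _)))

theorem5p5 : (c : ℕ) → 2 ≤ c → FormationWidth (I c ++ D c ++ I c ++ D c) (2 * c + 3)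
theorem5p5 c 2≤c = IDID-admissible c , IDID-inadmissible c 2≤c
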